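{- Let $\Gamma$ be an inseparable weighted oriented graph with $n\geq 5$ vertices. Then there is a vertex $v$ of $\Gamma$ such that the induced weighted oriented graph $\Gamma[V\setminus\{v\}]$ on $n-1$ vertices is inseparable.
   Context: A weighted oriented graph $\Gamma$ with finite vertex set $V$ consists of a set of arcs, i.e. ordered pairs $(x,y)$ of distinct vertices, such that for any distinct $x,y$ at most one of $(x,y),(y,x)$ is an arc, each arc carrying a weight in $(1/2,1]$. For $Z\subseteq V$, $\Gamma[Z]$ is the induced weighted oriented graph on $Z$. A clan of $\Gamma$ is a subset $X\subseteq V$ such that for every $x\in V\setminus X$, one of the following holds: there is no arc between $x$ and any vertex of $X$; or for some weight $\alpha$, $(x,y)$ is an arc of weight $\alpha$ for all $y\in X$; or for some weight $\alpha$, $(y,x)$ is an arc of weight $\alpha$ for all $y\in X$. $\Gamma$ is separable if $V$ can be partitioned into two nonempty clans, and inseparable otherwise. -}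

module Defs where

open import Data.Bool.Base using (T)
open import Data.Maybe.Base using (Maybe; just; is-just)
open import Data.Maybe.Relation.Binary.Pointwise using (Pointwise)
open import Data.Product using (_×_; ∃₂; ∃-syntax)
open import Data.Rational using (ℚ; ½; 1ℚ; _<_)
open import Data.Refinement using (Refinement; value)
open import Data.Sum using (_⊎_)
open import Function.Bundles using (_⇔_)
open import Level using (0ℓ)
open import Relation.Binary.Core using (Rel)
open import Relation.Binary.Definitions using (Asymmetric; Irreflexive)
open import Relation.Binary.PropositionalEquality using (_≡_; refl)
open import Relation.Nullary using (¬_)
open import Relation.Unary
  using (Pred; _∈_; _∉_; _∪_; _⊥_; _≐_; Satisfiable; Universal)

-- Real numbers as two-sided Dedekind cuts: lower x is { q ∣ q < x } and
-- upper x is { q ∣ x < q }.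
record ℝ : Set₁ where
  field
    lower upper     : Pred ℚ 0ℓ
    lower-inhabited : Satisfiable lower
    upper-inhabited : Satisfiable upper
    lower-rounded   : ∀ q → q ∈ lower ⇔ (∃[ r ] q < r × r ∈ lower)
    upper-rounded   : ∀ r → r ∈ upper ⇔ (∃[ q ] q < r × q ∈ upper)
    disjoint        : lower ⊥ upper
    located         : ∀ {q r} → q < r → q ∈ lower ⊎ r ∈ upper

open ℝ public

infix 4 _≃_

-- Equality of reals.  Propositional equality of the records would be too
-- fine: it also distinguishes different presentations of the same cut.
_≃_ : Rel ℝ 0ℓ
x ≃ y = lower x ≐ lower y × upper x ≐ upper y

-- A real in (1/2, 1]; the upper bound w ≤ 1 is expressed as ¬ (1 < w).
record Weight : Set₁ where
  field
    real   : ℝ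
    ½<real : ½ ∈ lower real
    real≤1 : 1ℚ ∉ lower real

open Weight public

infix 4 _≃ʷ_

_≃ʷ_ : Rel Weight 0ℓ
w ≃ʷ w′ = real w ≃ real w′

-- arc x y is just w if (x , y) is an arc of weight w, and nothing if
-- (x , y) is not an arc.
record WeightedOrientedGraph (V : Set) : Set₁ where
  field
    arc : V → V → Maybe Weight

  Arc : Rel V 0ℓ
  Arc x y = T (is-just (arc x y))

  field
    arc-irrefl : Irreflexive _≡_ Arc
    arc-asym   : Asymmetric Arc

module _ {V : Set} (Γ : WeightedOrientedGraph V) where

  open WeightedOrientedGraph Γ

  ArcOfWeight : Weight → V → V → Set₁
  ArcOfWeight α x y = Pointwise _≃ʷ_ (arc x y) (just α)

  IsClan : Pred V 0ℓ → Set₁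
  IsClan X = ∀ x → x ∉ X →
      (∀ y → y ∈ X → ¬ Arc x y × ¬ Arc y x)
    ⊎ (∃[ α ] (∀ y → y ∈ X → ArcOfWeight α x y))
    ⊎ (∃[ α ] (∀ y → y ∈ X → ArcOfWeight α y x))

  Separable : Set₁
  Separable = ∃₂ λ (X Y : Pred V 0ℓ) →
    Satisfiable X × Satisfiable Y ×
    X ⊥ Y × Universal (X ∪ Y) ×
    IsClan X × IsClan Y

  Inseparable : Set₁
  Inseparable = ¬ Separable

-- The vertices of the induced graph are those of Z.  Membership in Z is
-- recorded irrelevantly, so each vertex in Z occurs exactly once.
infix 8 _[_]

_[_] : {V : Set} → WeightedOrientedGraph V → (Z : Pred V 0ℓ) →
       WeightedOrientedGraph (Refinement V Z)
Γ [ Z ] = record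
  { arc        = λ x y → arc (value x) (value y)
  ; arc-irrefl = λ { refl → arc-irrefl refl }
  ; arc-asym   = arc-asym
  }
  where open WeightedOrientedGraph Γ

{-# OPTIONS --safe #-}

-- Call S ⊆ V inseparable if Γ[S] is, and suppose that S is inseparable with
-- 2 ≤ |S| < |V|.  If some u ∉ S is not uniform on S, then S ∪ {u} is again
-- inseparable: a separation cannot split S, so it would separate u from S.
-- If every vertex outside S is uniform on S, then S may be shrunk to any
-- nonempty subset without making V separable, so any vertex of S can be
-- deleted.  Growing S therefore ends with a vertex that can be deleted.
--
-- It remains to find such an S with at most four vertices.  Take a separation
-- of V \ {v}, and call a vertex good if v looks to it like the vertices of
-- the other side.  Both sides contain bad vertices, since otherwise V would be
-- separable.  If bad b and b′ on opposite sides look different from v, then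
-- {b, v, b′} is inseparable.  Otherwise some vertex is good, since {v} cannot
-- be separated from the rest.  Nor can the good vertices on its side, so on
-- that side there are a good g and a bad b such that b and v look different
-- from g; with b′ bad on the other side, {g, b, v, b′} is inseparable.
module Submission where

open import Defs
open import Axiom.ExcludedMiddle using (ExcludedMiddle)
open import Data.Bool.Base using (Bool; true; false; not; T)
import Data.Bool.Properties as Bool
open import Data.Fin.Base using (Fin)
open import Data.Fin.Properties using (injective⇒≤)
open import Data.Irrelevant using () renaming ([_] to irrelevant)
open import Data.List.Base using (List; []; _∷_; length; lookup; filter; tabulate)
open import Data.List.Membership.Propositional using (lose) renaming (_∈_ to _∈ˡ_; _∉_ to _∉ˡ_)
open import Data.List.Membership.Propositional.Properties using (∈-filter⁺; ∈-tabulate⁺)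
open import Data.List.Properties using (filter-notAll)
open import Data.List.Relation.Unary.Any using (here; there; index)
open import Data.List.Relation.Unary.Any.Properties using (lookup-index)
open import Data.Maybe.Base using (Maybe; just; nothing; is-just)
open import Data.Maybe.Relation.Binary.Pointwise as Pointwise using (Pointwise; just; nothing)
open import Data.Nat.Base using (ℕ; _≥_; _≤_; _<_; z≤n; s≤s)
open import Data.Nat.Induction using (<-wellFounded)
open import Data.Nat.Properties using (≤-refl; ≤-trans; <⇒≱; n≤1+n)
open import Data.Product using (_×_; _,_; ∃-syntax; proj₁; proj₂; swap)
open import Data.Refinement using (value; _,_)
open import Data.Sum using (_⊎_; inj₁; inj₂)
open import Function.Base using (id; _∘_)
open import Function.Bundles using (_↔_; module Inverse)
open import Induction.WellFounded using (Acc; acc)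
open import Level using (0ℓ; suc)
open import Relation.Binary.Bundles using (Setoid)
open import Relation.Binary.PropositionalEquality
  using (_≡_; _≢_; refl; sym; trans; cong; subst; ≢-sym)
open import Relation.Binary.Structures using (IsEquivalence)
open import Relation.Nullary
  using (¬_; Dec; yes; no; does; contradiction; contradiction-irr; decidable-stable; ¬?;
         True; recompute; toWitness; fromWitness)
open import Relation.Unary
  using (Pred; _∈_; _∉_; _∪_; _⊆_; Satisfiable; U; ∁; ｛_｝)

≢-≢⇒≡ : ∀ {a b c : Bool} → a ≢ b → a ≢ c → b ≡ c
≢-≢⇒≡ a≢b a≢c = Bool.not-injective (trans (sym (Bool.¬-not a≢b)) (Bool.¬-not a≢c))

-- Separations of colored vertex sets.

module Coloring {V : Set} (K : Setoid (suc 0ℓ) 0ℓ) (c : V → V → Setoid.Carrier K) where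

  open Setoid K using (_≈_)

  -- The color c x y of an ordered pair encodes the arcs in both directions, and
  -- uniform says that each of the two sides is a clan of the structure on S.
  record Separation (S : Pred V 0ℓ) : Set where
    field
      side    : V → Bool
      {p q}   : V
      p∈      : p ∈ S
      q∈      : q ∈ S
      p≢q     : side p ≢ side q
      uniform : ∀ {x y z} → x ∈ S → y ∈ S → z ∈ S →
                side x ≢ side y → side x ≢ side z → c x y ≈ c x z

  -- Inseparability of the structure induced on `S`, stated without passing to a subtype.
  Solid : Pred V 0ℓ → Set
  Solid S = ¬ Separation S

  restrict : ∀ {S T} → S ⊆ T → (σ : Separation T) → let open Separation σ in
             ∀ {x y} → x ∈ S → y ∈ S → side x ≢ side y → Separation S
  restrict S⊆T σ x∈ y∈ x≢y = record
    { side = side ; p∈ = x∈ ; q∈ = y∈ ; p≢q = x≢y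
    ; uniform = λ x∈ y∈ z∈ → uniform (S⊆T x∈) (S⊆T y∈) (S⊆T z∈)
    }
    where open Separation σ

-- Building separations and growing solid sets.

module Deletion
  (em : ExcludedMiddle 0ℓ) {V : Set} (K : Setoid (suc 0ℓ) 0ℓ) (c : V → V → Setoid.Carrier K)
  (c-swap : ∀ {x y z w} → Setoid._≈_ K (c x y) (c z w) → Setoid._≈_ K (c y x) (c w z))
  where

  open Setoid K using (_≈_; _≉_)
    renaming (refl to ≈-refl; sym to ≈-sym; trans to ≈-trans)
  open Coloring K c

  dne : {P : Set} → ¬ ¬ P → P
  dne = decidable-stable em

  -- The vertex `r` represents the complement. Reversing the colors in `toward`, every `x` outside
  -- `X` sees a member of `X` as `r` does, so `from` carries over from `r` to `x`.
  separate : ∀ {X : Pred V 0ℓ} {x₀ r} → x₀ ∈ X → r ∉ X →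
             (∀ {x y} → x ∈ X → y ∉ X → c x y ≈ c x r) →
             (∀ {x y} → x ∈ X → y ∈ X → c r x ≈ c r y) →
             Separation U
  separate {X} {x₀} {r} x₀∈ r∉ toward from = record
    { side = λ x → does (em {x ∈ X}) ; p∈ = _ ; q∈ = _ ; p≢q = x₀≢r
    ; uniform = λ {x} {y} {z} _ _ _ → uniform x y z
    }
    where
    x₀≢r : does (em {x₀ ∈ X}) ≢ does (em {r ∈ X})
    x₀≢r with em {x₀ ∈ X} | em {r ∈ X}
    ... | yes _ | no _   = λ ()
    ... | _     | yes r∈ = contradiction r∈ r∉
    ... | no x₀∉ | _     = contradiction x₀∈ x₀∉

    uniform : ∀ x y z → does (em {x ∈ X}) ≢ does (em {y ∈ X}) →
              does (em {x ∈ X}) ≢ does (em {z ∈ X}) → c x y ≈ c x z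
    uniform x y z x≢y x≢z with em {x ∈ X} | em {y ∈ X} | em {z ∈ X}
    ... | yes _  | yes _  | _      = contradiction refl x≢y
    ... | yes _  | no _   | yes _  = contradiction refl x≢z
    ... | yes x∈ | no y∉  | no z∉  = ≈-trans (toward x∈ y∉) (≈-sym (toward x∈ z∉))
    ... | no _   | no _   | _      = contradiction refl x≢y
    ... | no _   | yes _  | no _   = contradiction refl x≢z
    ... | no x∉  | yes y∈ | yes z∈ =
      ≈-trans (c-swap (toward y∈ x∉)) (≈-trans (from y∈ z∈) (≈-sym (c-swap (toward z∈ x∉))))

  unsplit : ∀ {S T} → Solid S → S ⊆ T → (σ : Separation T) → let open Separation σ in
            ∀ {x y} → x ∈ S → y ∈ S → side x ≡ side y
  unsplit solid S⊆T σ x∈ y∈ =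
    decidable-stable (_ Bool.≟ _) λ x≢y → solid (restrict S⊆T σ x∈ y∈ x≢y)

  -- A separation leaves `S` on one side, hence `u` alone on the other, where uniformity would force
  -- `c u s ≈ c u t`.
  extend : ∀ {S u s t} → Solid S → s ∈ S → t ∈ S → c u s ≉ c u t → Solid (S ∪ ｛ u ｝)
  extend {S} {u} {s} {t} solid s∈ t∈ us≉ut σ = us≉ut
    (uniform (inj₂ refl) (inj₁ s∈) (inj₁ t∈) u≢s λ u≡t → u≢s (trans u≡t (same t∈ s∈)))
    where
    open Separation σ

    same : ∀ {x y} → x ∈ S → y ∈ S → side x ≡ side y
    same = unsplit solid inj₁ σ

    u≢s : side u ≢ side s
    u≢s u≡s = p≢q (trans (constant p∈) (sym (constant q∈)))
      where
      constant : ∀ {x} → x ∈ S ∪ ｛ u ｝ → side x ≡ side s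
      constant (inj₁ x∈)   = same x∈ s∈
      constant (inj₂ refl) = u≡s

  -- Modules, which are clans in terms of colors, and the deletion of their vertices.

  Module : Pred V 0ℓ → Set
  Module S = ∀ {u s t} → u ∉ S → s ∈ S → t ∈ S → c u s ≈ c u t

  module _ {S : Pred V 0ℓ} {a b w} (mod : Module S)
           (a∈ : a ∈ S) (b∈ : b ∈ S) (a≢b : a ≢ b) (w∉ : w ∉ S)
           (σ : Separation (∁ ｛ a ｝)) where

    open Separation σ

    private
      outside : ∀ {x} → x ∉ S → a ≢ x
      outside x∉ refl = x∉ a∈

    -- The vertices outside `S` on the side of `w` are cut off from all others. They see `S`
    -- uniformly, and they see the outside vertices across from them as they see `s`.
    split⇒separation : ∀ {s t} → s ∈ S → a ≢ s → t ∈ S → a ≢ t →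
                       side s ≢ side w → side t ≡ side w → Separation U
    split⇒separation {s} {t} s∈ a≢s t∈ a≢t s≢w t≡w =
      separate {X = λ x → x ∉ S × side x ≡ side w} (w∉ , refl) (λ (s∉ , _) → s∉ s∈)
        toward
        (λ (x∉ , x≡w) (y∉ , y≡w) → uniform a≢s (outside x∉) (outside y∉)
           (λ s≡x → s≢w (trans s≡x x≡w)) (λ s≡y → s≢w (trans s≡y y≡w)))
      where
      toward : ∀ {x y} → x ∉ S × side x ≡ side w → ¬ (y ∉ S × side y ≡ side w) → c x y ≈ c x s
      toward {x} {y} (x∉ , x≡w) y∉X with em {y ∈ S}
      ... | yes y∈ = mod x∉ y∈ s∈
      ... | no y∉  = uniform (outside x∉) (outside y∉) a≢s
        (λ x≡y → y∉X (y∉ , trans (sym x≡y) x≡w)) (λ x≡s → s≢w (trans (sym x≡s) x≡w))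

    -- Here `a` joins the side of `b`. Any vertex across from them lies outside `S`, so `mod` makes
    -- `a` and `b` look alike to it.
    unsplit⇒separation : (∀ {s} → s ∈ S → a ≢ s → side s ≡ side b) → Separation U
    unsplit⇒separation same = record
      { side = side ∘ r ; p∈ = _ ; q∈ = _
      ; p≢q = λ rp≡rq → p≢q (trans (cong side (sym (r-id p∈))) (trans rp≡rq (cong side (r-id q∈))))
      ; uniform = λ {x} {y} {z} _ _ _ x≢y x≢z →
          ≈-trans (pull x≢y) (≈-trans (uniform (r-∉ x) (r-∉ y) (r-∉ z) x≢y x≢z) (≈-sym (pull x≢z)))
      }
      where
      r : V → V
      r x with em {a ≡ x}
      ... | yes _ = b
      ... | no _  = x

      r-∉ : ∀ x → a ≢ r x
      r-∉ x with em {a ≡ x}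
      ... | yes _  = a≢b
      ... | no a≢x = a≢x

      r-id : ∀ {x} → a ≢ x → r x ≡ x
      r-id {x} a≢x with em {a ≡ x}
      ... | yes a≡x = contradiction a≡x a≢x
      ... | no _    = refl

      pull : ∀ {x y} → side (r x) ≢ side (r y) → c x y ≈ c (r x) (r y)
      pull {x} {y} x≢y with em {a ≡ x} | em {a ≡ y}
      ... | yes _    | yes _    = contradiction refl x≢y
      ... | yes refl | no a≢y   = c-swap (mod (λ y∈ → x≢y (sym (same y∈ a≢y))) a∈ b∈)
      ... | no a≢x   | yes refl = mod (λ x∈ → x≢y (same x∈ a≢x)) a∈ b∈
      ... | no _     | no _     = ≈-refl

    lift-separation : Separation U
    lift-separation with em {∃[ s ] s ∈ S × a ≢ s × side s ≢ side b}
    ... | no same = unsplit⇒separation λ s∈ a≢s →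
      decidable-stable (_ Bool.≟ _) λ s≢b → same (_ , s∈ , a≢s , s≢b)
    ... | yes (s , s∈ , a≢s , s≢b) with side b Bool.≟ side w
    ...   | yes b≡w = split⇒separation s∈ a≢s b∈ a≢b (λ s≡w → s≢b (trans s≡w (sym b≡w))) b≡w
    -- Of `b` and `s`, which lie on opposite sides, now `s` is the one beside `w`.
    ...   | no b≢w  = split⇒separation b∈ a≢b s∈ a≢s b≢w (≢-≢⇒≡ (≢-sym s≢b) b≢w)

  -- The list `us` covers the complement of `S` and its length is the measure: once `u` has joined
  -- `S`, it can be filtered out. The vertex `w` witnesses that `S` is not yet everything.
  deletable : Solid U → ∀ {S a b w} us → Acc _<_ (length us) → (∀ {x} → x ∉ S → x ∈ˡ us) →
              Solid S → a ∈ S → b ∈ S → a ≢ b → w ∉ S → ∃[ v ] Solid (∁ ｛ v ｝)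
  deletable solidU {S} {a} us (acc rec) cover solid a∈ b∈ a≢b w∉
    with em {∃[ u ] ∃[ s ] ∃[ t ] u ∉ S × s ∈ S × t ∈ S × c u s ≉ c u t}
  -- Now `S` is a module, so a separation after deleting `a` would lift to all of `V`.
  ... | no none = a , λ σ → solidU
    (lift-separation (λ u∉ s∈ t∈ → dne λ us≉ut → none (_ , _ , _ , u∉ , s∈ , t∈ , us≉ut)) a∈ b∈ a≢b w∉ σ)
  ... | yes (u , s , t , u∉ , s∈ , t∈ , us≉ut) with em {∃[ x ] x ∉ S ∪ ｛ u ｝}
  ...   | yes (x , x∉) =
    deletable solidU (filter u≢? us) (rec (filter-notAll u≢? us (lose (cover u∉) λ u≢u → u≢u refl)))
      (λ y∉ → ∈-filter⁺ u≢? (cover (y∉ ∘ inj₁)) (y∉ ∘ inj₂))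
      (extend solid s∈ t∈ us≉ut) (inj₁ a∈) (inj₁ b∈) a≢b x∉
    where
    u≢? : ∀ x → Dec (u ≢ x)
    u≢? x = ¬? em
  -- Only `u` lies outside `S`, so deleting it leaves vertices of the solid `S` alone.
  ...   | no full = u , λ σ → let open Separation σ in
    solid (restrict (λ { x∈ refl → u∉ x∈ }) σ (rest p∈) (rest q∈) p≢q)
    where
    rest : ∀ {x} → u ≢ x → x ∈ S
    rest u≢x = dne λ x∉ → full (_ , λ { (inj₁ x∈) → x∉ x∈ ; (inj₂ u≡x) → u≢x u≡x })

  -- Solid sets of three and four vertices.

  triple-solid : ∀ {x y z} → c x y ≉ c x z → c y x ≉ c y z → c z x ≉ c z y →
                 Solid (_∈ˡ x ∷ y ∷ z ∷ [])
  triple-solid {x} {y} {z} x:yz y:xz z:xy σ = p≢q (trans (same p∈) (sym (same q∈)))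
    where
    open Separation σ
    ∈x = here refl
    ∈y = there (here refl)
    ∈z = there (there (here refl))

    -- A proper splitting isolates one vertex, which must see the other two alike; each hypothesis
    -- excludes this for one vertex.
    y≡x×z≡x : side y ≡ side x × side z ≡ side x
    y≡x×z≡x with side x | side y | side z | uniform ∈x ∈y ∈z | uniform ∈y ∈x ∈z | uniform ∈z ∈x ∈y
    ... | true  | true  | true  | _ | _ | _ = refl , refl
    ... | false | false | false | _ | _ | _ = refl , refl
    ... | true  | false | false | h | _ | _ = contradiction (h (λ ()) (λ ())) x:yz
    ... | false | true  | true  | h | _ | _ = contradiction (h (λ ()) (λ ())) x:yz
    ... | true  | false | true  | _ | h | _ = contradiction (h (λ ()) (λ ())) y:xz
    ... | false | true  | false | _ | h | _ = contradiction (h (λ ()) (λ ())) y:xz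
    ... | true  | true  | false | _ | _ | h = contradiction (h (λ ()) (λ ())) z:xy
    ... | false | false | true  | _ | _ | h = contradiction (h (λ ()) (λ ())) z:xy

    same : ∀ {t} → t ∈ˡ x ∷ y ∷ z ∷ [] → side t ≡ side x
    same (here refl)                 = refl
    same (there (here refl))         = proj₁ y≡x×z≡x
    same (there (there (here refl))) = proj₂ y≡x×z≡x

  -- Up to exchanging the sides, four vertices split in seven ways. Each of the five hypotheses
  -- excludes two of these, and together they exclude all seven.
  quadruple-solid : ∀ {g b v y} → c g b ≉ c g v → c g b ≉ c g y → c b v ≉ c b y →
                    c v g ≉ c v b → c y g ≉ c y v → Solid (_∈ˡ g ∷ b ∷ v ∷ y ∷ [])
  quadruple-solid {g} {b} {v} {y} g:bv g:by b:vy v:gb y:gv σ = p≢q (trans (same p∈) (sym (same q∈)))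
    where
    open Separation σ
    ∈g = here refl
    ∈b = there (here refl)
    ∈v = there (there (here refl))
    ∈y = there (there (there (here refl)))

    equal : side b ≡ side g × side v ≡ side g × side y ≡ side g
    equal with side g | side b | side v | side y
             | uniform ∈g ∈b ∈v | uniform ∈g ∈b ∈y | uniform ∈b ∈v ∈y
             | uniform ∈v ∈g ∈b | uniform ∈y ∈g ∈v
    ... | true  | true  | true  | true  | _ | _ | _ | _ | _ = refl , refl , refl
    ... | false | false | false | false | _ | _ | _ | _ | _ = refl , refl , refl
    ... | true  | false | false | _     | h | _ | _ | _ | _ = contradiction (h (λ ()) (λ ())) g:bv
    ... | false | true  | true  | _     | h | _ | _ | _ | _ = contradiction (h (λ ()) (λ ())) g:bv
    ... | true  | false | true  | false | _ | h | _ | _ | _ = contradiction (h (λ ()) (λ ())) g:by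
    ... | false | true  | false | true  | _ | h | _ | _ | _ = contradiction (h (λ ()) (λ ())) g:by
    ... | true  | false | true  | true  | _ | _ | h | _ | _ = contradiction (h (λ ()) (λ ())) b:vy
    ... | false | true  | false | false | _ | _ | h | _ | _ = contradiction (h (λ ()) (λ ())) b:vy
    ... | true  | true  | false | false | _ | _ | h | _ | _ = contradiction (h (λ ()) (λ ())) b:vy
    ... | false | false | true  | true  | _ | _ | h | _ | _ = contradiction (h (λ ()) (λ ())) b:vy
    ... | true  | true  | false | true  | _ | _ | _ | h | _ = contradiction (h (λ ()) (λ ())) v:gb
    ... | false | false | true  | false | _ | _ | _ | h | _ = contradiction (h (λ ()) (λ ())) v:gb
    ... | true  | true  | true  | false | _ | _ | _ | _ | h = contradiction (h (λ ()) (λ ())) y:gv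
    ... | false | false | false | true  | _ | _ | _ | _ | h = contradiction (h (λ ()) (λ ())) y:gv

    same : ∀ {t} → t ∈ˡ g ∷ b ∷ v ∷ y ∷ [] → side t ≡ side g
    same (here refl)                         = refl
    same (there (here refl))                 = proj₁ equal
    same (there (there (here refl)))         = proj₁ (proj₂ equal)
    same (there (there (there (here refl)))) = proj₂ (proj₂ equal)

  -- With at least five vertices in all, the bound four leaves one outside; `a` and `b` are the two
  -- distinct members with which `deletable` starts.
  SmallSolid : Set
  SmallSolid = ∃[ xs ] length xs ≤ 4 × Solid (_∈ˡ xs) × ∃[ a ] ∃[ b ] a ∈ˡ xs × b ∈ˡ xs × a ≢ b

  -- Good and bad vertices for a separation of the complement of `v`.

  module _ (solidU : Solid U) {v} (σ : Separation (∁ ｛ v ｝)) where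

    open Separation σ

    Good Bad : Pred V 0ℓ
    Good x = v ≢ x × (∀ {y} → v ≢ y → side x ≢ side y → c x v ≈ c x y)
    Bad x  = v ≢ x × (∀ {y} → v ≢ y → side x ≢ side y → c x v ≉ c x y)

    -- By uniformity, `x` sees all vertices across from it alike, so comparing `v` with one of them
    -- decides for all.
    good⊎bad : ∀ {x} → v ≢ x → Good x ⊎ Bad x
    good⊎bad {x} v≢x with em {∃[ y ] v ≢ y × side x ≢ side y × c x v ≈ c x y}
    ... | yes (y , v≢y , x≢y , xv≈xy) =
      inj₁ (v≢x , λ v≢z x≢z → ≈-trans xv≈xy (uniform v≢x v≢y v≢z x≢y x≢z))
    ... | no none =
      inj₂ (v≢x , λ v≢y x≢y xv≈xy → none (_ , v≢y , x≢y , xv≈xy))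

    -- If the side of `s` had only good vertices, these would see `v` as they see `t`, and that side
    -- could be separated from the rest of `V`.
    bad-beside : ∀ {s t} → v ≢ s → v ≢ t → side s ≢ side t → ∃[ b ] Bad b × side b ≡ side s
    bad-beside {s} {t} v≢s v≢t s≢t = dne λ none → solidU (separation none)
      where
      X : Pred V 0ℓ
      X x = v ≢ x × side x ≡ side s

      t≢ : ∀ {x} → side x ≡ side s → side t ≢ side x
      t≢ x≡s t≡x = s≢t (sym (trans t≡x x≡s))

      module _ (none : ¬ (∃[ b ] Bad b × side b ≡ side s)) where

        toward : ∀ {x y} → x ∈ X → y ∉ X → c x y ≈ c x t
        toward {x} {y} (v≢x , x≡s) y∉ with em {v ≡ y} | good⊎bad v≢x
        ... | yes refl | inj₁ (_ , good) = good v≢t (≢-sym (t≢ x≡s))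
        ... | yes refl | inj₂ bad        = contradiction (_ , bad , x≡s) none
        ... | no v≢y   | _               =
          uniform v≢x v≢y v≢t (λ x≡y → y∉ (v≢y , trans (sym x≡y) x≡s)) (≢-sym (t≢ x≡s))

        separation : Separation U
        separation = separate {X = X} (v≢s , refl) (λ (_ , t≡s) → s≢t (sym t≡s)) toward
          (λ (v≢x , x≡s) (v≢y , y≡s) → uniform v≢t v≢x v≢y (t≢ x≡s) (t≢ y≡s))

    bad-triple : ∀ {b b′} → Bad b → Bad b′ → side b ≢ side b′ → c v b ≉ c v b′ → SmallSolid
    bad-triple {b} {b′} (v≢b , bad) (v≢b′ , bad′) b≢b′ vb≉vb′ =
      v ∷ b ∷ b′ ∷ [] , n≤1+n 3 ,
      triple-solid vb≉vb′ (bad v≢b′ b≢b′) (bad′ v≢b (≢-sym b≢b′)) ,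
      v , b , here refl , there (here refl) , v≢b

    mixed-quadruple : ∀ {g b b′} → Good g → Bad b → Bad b′ → side g ≡ side b → side b ≢ side b′ →
                      c g b ≉ c g v → SmallSolid
    mixed-quadruple {g} {b} {b′} (v≢g , good) (v≢b , bad) (v≢b′ , bad′) g≡b b≢b′ gb≉gv =
      g ∷ b ∷ v ∷ b′ ∷ [] , ≤-refl ,
      quadruple-solid gb≉gv
        (λ gb≈gb′ → gb≉gv (≈-trans gb≈gb′ (≈-sym gv≈gb′)))
        (bad v≢b′ b≢b′)
        -- Otherwise `b` sees `v` as `g` does, `g` sees `v` as it sees `b′`, and `b′` looks the same
        -- from `g` and `b`; then `b` would not be bad.
        (λ vg≈vb → bad v≢b′ b≢b′ (≈-trans (c-swap (≈-sym vg≈vb)) (≈-trans gv≈gb′ (c-swap b′g≈b′b))))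
        (λ b′g≈b′v → bad′ v≢b (≢-sym b≢b′) (≈-trans (≈-sym b′g≈b′v) b′g≈b′b)) ,
      g , v , here refl , there (there (here refl)) , ≢-sym v≢g
      where
      g≢b′ : side g ≢ side b′
      g≢b′ g≡b′ = b≢b′ (trans (sym g≡b) g≡b′)

      gv≈gb′ : c g v ≈ c g b′
      gv≈gb′ = good v≢b′ g≢b′

      b′g≈b′b : c b′ g ≈ c b′ b
      b′g≈b′b = uniform v≢b′ v≢g v≢b (≢-sym g≢b′) (≢-sym b≢b′)

    good-exists : ¬ SmallSolid → ∃[ g ] Good g
    good-exists none = dne λ no-good → solidU (separation no-good)
      where
      module _ (no-good : ¬ (∃[ g ] Good g)) where

        bad : ∀ {x} → v ≢ x → Bad x
        bad v≢x with good⊎bad v≢x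
        ... | inj₁ good = contradiction (_ , good) no-good
        ... | inj₂ bad  = bad

        opposite : ∀ {x y} → v ≢ x → v ≢ y → side x ≢ side y → c v x ≈ c v y
        opposite v≢x v≢y x≢y = dne (none ∘ bad-triple (bad v≢x) (bad v≢y) x≢y)

        toward : ∀ {y} → v ≢ y → c v y ≈ c v p
        toward {y} v≢y with side y Bool.≟ side p
        ... | no y≢p  = opposite v≢y p∈ y≢p
        -- Two vertices on the side of `p` are compared through `q` across from them.
        ... | yes y≡p = ≈-trans (opposite v≢y q∈ (λ y≡q → p≢q (trans (sym y≡p) y≡q)))
                                (opposite q∈ p∈ (≢-sym p≢q))

        separation : Separation U
        separation = separate {X = ｛ v ｝} refl p∈ (λ { refl → toward }) (λ { refl refl → ≈-refl })

    opposite-of : ∀ {x} → ∃[ y ] v ≢ y × side x ≢ side y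
    opposite-of {x} with side x Bool.≟ side p
    ... | no x≢p  = p , p∈ , x≢p
    ... | yes x≡p = q , q∈ , λ x≡q → p≢q (trans (sym x≡p) x≡q)

    small-solid : SmallSolid
    small-solid = dne λ none → solidU (separation none)
      where
      module _ (none : ¬ SmallSolid) where
        g = proj₁ (good-exists none)

        good-g : Good g
        good-g = proj₂ (good-exists none)

        bad-opposite : ∃[ b ] Bad b × side g ≢ side b
        bad-opposite with y , v≢y , g≢y ← opposite-of {g}
                     with b , bad , b≡y ← bad-beside v≢y (proj₁ good-g) (≢-sym g≢y) =
          b , bad , λ g≡b → g≢y (trans g≡b b≡y)

        b′ = proj₁ bad-opposite

        bad-b′ : Bad b′
        bad-b′ = proj₁ (proj₂ bad-opposite)

        g≢b′ : side g ≢ side b′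
        g≢b′ = proj₂ (proj₂ bad-opposite)

        -- Without a small solid set, the good vertices beside `g` could be separated from the rest,
        -- represented by the bad vertex `b′` across.
        X : Pred V 0ℓ
        X x = Good x × side x ≡ side g

        opposite-b′ : ∀ {x} → side x ≡ side g → side x ≢ side b′
        opposite-b′ x≡g x≡b′ = g≢b′ (trans (sym x≡g) x≡b′)

        toward : ∀ {x y} → x ∈ X → y ∉ X → c x y ≈ c x b′
        toward {x} {y} (good@(v≢x , xv≈) , x≡g) y∉ with em {v ≡ y} | side x Bool.≟ side y
        ... | yes refl | _      = xv≈ (proj₁ bad-b′) (opposite-b′ x≡g)
        ... | no v≢y   | no x≢y = uniform v≢x v≢y (proj₁ bad-b′) x≢y (opposite-b′ x≡g)
        ... | no v≢y   | yes x≡y with good⊎bad v≢y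
        ...   | inj₁ good-y = contradiction (good-y , trans (sym x≡y) x≡g) y∉
        -- In the absence of a solid quadruple, `x` sees the bad `y` as it sees `v`, and so, being
        -- good, as it sees `b′`.
        ...   | inj₂ bad-y  = ≈-trans
          (dne (none ∘ mixed-quadruple good bad-y bad-b′ x≡y (opposite-b′ (trans (sym x≡y) x≡g))))
          (xv≈ (proj₁ bad-b′) (opposite-b′ x≡g))

        separation : Separation U
        separation = separate {X = X} (good-g , refl) (λ (_ , b′≡g) → g≢b′ (sym b′≡g)) toward
          (λ ((v≢x , _) , x≡g) ((v≢y , _) , y≡g) →
             uniform (proj₁ bad-b′) v≢x v≢y (≢-sym (opposite-b′ x≡g)) (≢-sym (opposite-b′ y≡g)))

  solid-deletion : (vs : List V) → (∀ x → x ∈ˡ vs) →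
                   (∀ xs → length xs ≤ 4 → ∃[ w ] w ∉ˡ xs) →
                   Solid U → ∃[ v ] Solid (∁ ｛ v ｝)
  -- The empty list makes `room` yield some vertex `v`, whose deletion is tried first.
  solid-deletion vs complete room solidU with v , _ ← room [] z≤n with em {Separation (∁ ｛ v ｝)}
  ... | no solid = v , solid
  ... | yes σ with xs , len , solid , a , b , a∈ , b∈ , a≢b ← small-solid solidU σ
              with w , w∉ ← room xs len =
    deletable solidU vs (<-wellFounded _) (λ {x} _ → complete x) solid a∈ b∈ a≢b w∉

-- Colors, clans and separations of a weighted oriented graph.

module _ (em : ExcludedMiddle 0ℓ) where

  ≃ʷ-isEquivalence : IsEquivalence _≃ʷ_
  ≃ʷ-isEquivalence = record
    { refl  = (id , id) , (id , id)
    ; sym   = λ (l , u) → swap l , swap u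
    ; trans = λ ((l₁ , l₂) , (u₁ , u₂)) ((l₃ , l₄) , (u₃ , u₄)) →
        (l₃ ∘ l₁ , l₂ ∘ l₄) , (u₃ ∘ u₁ , u₂ ∘ u₄)
    }

  open IsEquivalence (Pointwise.isEquivalence ≃ʷ-isEquivalence)
    renaming (refl to ≋-refl; sym to ≋-sym; trans to ≋-trans)

  _≋?_ : (m m′ : Maybe Weight) → Dec (Pointwise _≃ʷ_ m m′)
  _≋?_ = Pointwise.dec (λ _ _ → em)

  -- Pointwise lives in Set₁; its decision brings it down to Set, where
  -- excluded middle applies.
  colors : Setoid (suc 0ℓ) 0ℓ
  colors = record
    { Carrier = Maybe Weight × Maybe Weight
    ; _≈_ = λ (m , m′) (n , n′) → True (m ≋? n) × True (m′ ≋? n′)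
    ; isEquivalence = record
      { refl  = fromWitness ≋-refl , fromWitness ≋-refl
      ; sym   = λ (e , e′) → fromWitness (≋-sym (toWitness e)) , fromWitness (≋-sym (toWitness e′))
      ; trans = λ (e , e′) (f , f′) →
          fromWitness (≋-trans (toWitness e) (toWitness f)) ,
          fromWitness (≋-trans (toWitness e′) (toWitness f′))
      }
    }

  module _ {V : Set} (Γ : WeightedOrientedGraph V) where

    open WeightedOrientedGraph Γ
    open Setoid colors using (_≈_)

    color : V → V → Maybe Weight × Maybe Weight
    color x y = arc x y , arc y x

    open Coloring colors color

    absent : ∀ {m : Maybe Weight} → ¬ T (is-just m) → Pointwise _≃ʷ_ m nothing
    absent {just _}  ¬m = contradiction _ ¬m
    absent {nothing} _  = nothing

    -- A clan of the second or third kind prescribes arcs in one direction; asymmetry supplies the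
    -- other component of the color.
    reverse-absent : ∀ {α x y} → ArcOfWeight Γ α x y → Pointwise _≃ʷ_ (arc y x) nothing
    reverse-absent {x = x} {y} xy≋α = absent (arc-asym (present xy≋α))
      where
      present : ∀ {m α} → Pointwise _≃ʷ_ m (just α) → T (is-just m)
      present (just _) = _

    ≈-via : ∀ {x y z w m m′} →
            Pointwise _≃ʷ_ (arc x y) m → Pointwise _≃ʷ_ (arc y x) m′ →
            Pointwise _≃ʷ_ (arc z w) m → Pointwise _≃ʷ_ (arc w z) m′ → color x y ≈ color z w
    ≈-via xy yx zw wz = fromWitness (≋-trans xy (≋-sym zw)) , fromWitness (≋-trans yx (≋-sym wz))

    clan⇒uniform : ∀ {X x y z} → IsClan Γ X → x ∉ X → y ∈ X → z ∈ X → color x y ≈ color x z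
    clan⇒uniform {x = x} {y} {z} clan x∉ y∈ z∈ with clan x x∉
    ... | inj₁ none =
      ≈-via (absent (proj₁ (none y y∈))) (absent (proj₂ (none y y∈)))
            (absent (proj₁ (none z z∈))) (absent (proj₂ (none z z∈)))
    ... | inj₂ (inj₁ (α , out)) =
      ≈-via (out y y∈) (reverse-absent (out y y∈)) (out z z∈) (reverse-absent (out z z∈))
    ... | inj₂ (inj₂ (α , into)) =
      ≈-via (reverse-absent (into y y∈)) (into y y∈) (reverse-absent (into z z∈)) (into z z∈)

    -- The arcs between `x` and a sample `z` of `X` select the alternative, and uniformity transfers
    -- it to all of `X`.
    uniform⇒clan : ∀ {X} → Satisfiable X →
                   (∀ {x y z} → x ∉ X → y ∈ X → z ∈ X → color x y ≈ color x z) → IsClan Γ X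
    uniform⇒clan {X} (z , z∈) uniform x x∉
      with arc x z | arc z x
         | (λ y (y∈ : y ∈ X) → toWitness (proj₁ (uniform x∉ y∈ z∈)))
         | (λ y (y∈ : y ∈ X) → toWitness (proj₂ (uniform x∉ y∈ z∈)))
    ... | just α  | _       | out | _    = inj₂ (inj₁ (α , out))
    ... | nothing | just α  | _   | into = inj₂ (inj₂ (α , into))
    ... | nothing | nothing | out | into = inj₁ λ y y∈ → no-arc (out y y∈) , no-arc (into y y∈)
      where
      no-arc : ∀ {m} → Pointwise _≃ʷ_ m nothing → ¬ T (is-just m)
      no-arc nothing ()

    separable⇒separation : Separable Γ → Separation U
    separable⇒separation (X , Y , (p , p∈X) , (q , q∈Y) , X⊥Y , cover , clanX , clanY) = record
      { side = side ; p∈ = _ ; q∈ = _ ; p≢q = p≢q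
      ; uniform = λ {x} {y} {z} _ _ _ → uniform x y z
      }
      where
      side : V → Bool
      side x with cover x
      ... | inj₁ _ = true
      ... | inj₂ _ = false

      p≢q : side p ≢ side q
      p≢q with cover p | cover q
      ... | inj₁ _   | inj₂ _   = λ ()
      ... | inj₂ p∈Y | _        = contradiction (p∈X , p∈Y) X⊥Y
      ... | _        | inj₁ q∈X = contradiction (q∈X , q∈Y) X⊥Y

      uniform : ∀ x y z → side x ≢ side y → side x ≢ side z → color x y ≈ color x z
      uniform x y z x≢y x≢z with cover x | cover y | cover z
      ... | inj₁ _  | inj₁ _  | _       = contradiction refl x≢y
      ... | inj₁ _  | inj₂ _  | inj₁ _  = contradiction refl x≢z
      ... | inj₁ x∈ | inj₂ y∈ | inj₂ z∈ = clan⇒uniform clanY (λ x∈Y → X⊥Y (x∈ , x∈Y)) y∈ z∈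
      ... | inj₂ _  | inj₂ _  | _       = contradiction refl x≢y
      ... | inj₂ _  | inj₁ _  | inj₂ _  = contradiction refl x≢z
      ... | inj₂ x∈ | inj₁ y∈ | inj₁ z∈ = clan⇒uniform clanX (λ x∈X → X⊥Y (x∈X , x∈)) y∈ z∈

    separation⇒separable : Separation U → Separable Γ
    separation⇒separable σ =
      Side (side p) , Side (not (side p)) , (p , refl) , (q , q≡) ,
      (λ (x≡ , x≡not) → Bool.not-¬ x≡ x≡not) , cover ,
      clan (p , refl) , clan (q , q≡)
      where
      open Separation σ

      Side : Bool → Pred V 0ℓ
      Side s x = side x ≡ s

      q≡ : side q ≡ not (side p)
      q≡ = Bool.¬-not (≢-sym p≢q)

      cover : ∀ x → x ∈ Side (side p) ∪ Side (not (side p))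
      cover x with side x Bool.≟ side p
      ... | yes x≡p = inj₁ x≡p
      ... | no x≢p  = inj₂ (Bool.¬-not x≢p)

      clan : ∀ {s} → Satisfiable (Side s) → IsClan Γ (Side s)
      clan sat = uniform⇒clan sat λ x∉ y∈ z∈ →
        uniform _ _ _ (λ x≡y → x∉ (trans x≡y y∈)) (λ x≡z → x∉ (trans x≡z z∈))

  -- Separations of induced graphs.

  module _ {V : Set} (Γ : WeightedOrientedGraph V) where

    open Coloring colors (color Γ)

    induced-separation : ∀ {Z} → Coloring.Separation colors (color (Γ [ Z ])) U → Separation Z
    induced-separation {Z} σ = record
      { side = side′
      ; p∈ = member p
      ; q∈ = member q
      ; p≢q = λ p≡q → p≢q (trans (sym (side′-value p)) (trans p≡q (side′-value q)))
      ; uniform = λ x∈ y∈ z∈ x≢y x≢z →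
          uniform {x = _ , irrelevant x∈} {y = _ , irrelevant y∈} {z = _ , irrelevant z∈} _ _ _
            (lower-≢ x∈ y∈ x≢y) (lower-≢ x∈ z∈ x≢z)
      }
      where
      open Coloring.Separation σ

      member : ∀ x → value x ∈ Z
      -- Membership is stored irrelevantly; excluded middle makes it decidable and so recoverable.
      member (x , irrelevant x∈) = recompute em x∈

      side′ : V → Bool
      side′ x with em {x ∈ Z}
      ... | yes x∈ = side (x , irrelevant x∈)
      -- An arbitrary value: a separation of `Z` constrains sides only within `Z`.
      ... | no _   = true

      side′-value : ∀ x → side′ (value x) ≡ side x
      side′-value (x , irrelevant x∈) with em {x ∈ Z}
      ... | yes _ = refl
      ... | no x∉ = contradiction-irr x∈ x∉

      lower-≢ : ∀ {x y} (x∈ : x ∈ Z) (y∈ : y ∈ Z) → side′ x ≢ side′ y →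
                side (x , irrelevant x∈) ≢ side (y , irrelevant y∈)
      lower-≢ x∈ y∈ x≢y x≡y =
        x≢y (trans (side′-value (_ , irrelevant x∈))
            (trans x≡y (sym (side′-value (_ , irrelevant y∈)))))

-- Pigeonhole: if `xs` contained every vertex, positions in it would inject `Fin n` into
-- `Fin (length xs)`.
fresh-vertex : ExcludedMiddle 0ℓ → ∀ {V : Set} {n} → V ↔ Fin n →
               (xs : List V) → length xs < n → ∃[ w ] w ∉ˡ xs
fresh-vertex em {V} {n} V↔Fin xs xs<n with em {∃[ w ] w ∉ˡ xs}
... | yes fresh = fresh
... | no full   = contradiction (injective⇒≤ position-injective) (<⇒≱ xs<n)
  where
  open Inverse V↔Fin

  member : ∀ i → from i ∈ˡ xs
  member i = decidable-stable em λ i∉ → full (from i , i∉)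

  position : Fin n → Fin (length xs)
  position = index ∘ member

  position-injective : ∀ {i j} → position i ≡ position j → i ≡ j
  position-injective {i} {j} eq =
    trans (sym (strictlyInverseˡ i)) (trans (cong to from-i≡from-j) (strictlyInverseˡ j))
    where
    from-i≡from-j : from i ≡ from j
    from-i≡from-j = trans (lookup-index (member i))
      (trans (cong (lookup xs) eq) (sym (lookup-index (member j))))

theorem3p3 : ExcludedMiddle 0ℓ →
    {V : Set} (n : ℕ) → V ↔ Fin n → n ≥ 5 →
    (Γ : WeightedOrientedGraph V) → Inseparable Γ →
    ∃[ v ] Inseparable (Γ [ ∁ ｛ v ｝ ])
theorem3p3 em n V↔Fin n≥5 Γ inseparable =
  proj₁ deletion ,
  proj₂ deletion ∘ induced-separation em Γ ∘ separable⇒separation em (Γ [ ∁ ｛ _ ｝ ])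
  where
  open Inverse V↔Fin

  complete : ∀ x → x ∈ˡ tabulate from
  complete x = subst (_∈ˡ tabulate from) (strictlyInverseʳ x) (∈-tabulate⁺ (to x))

  -- Reversing a pair exchanges the two components of its color, so `swap` serves as `c-swap`.
  deletion : ∃[ v ] Coloring.Solid (colors em) (color em Γ) (∁ ｛ v ｝)
  deletion = Deletion.solid-deletion em (colors em) (color em Γ) swap (tabulate from) complete
    (λ xs len → fresh-vertex em V↔Fin xs (≤-trans (s≤s len) n≥5))
    (inseparable ∘ separation⇒separable em Γ)
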